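{- Let $s$ be any (finite) string over a linearly ordered alphabet, let $s=f_1^{e_1}\cdots f_m^{e_m}$ be its Lyndon factorization and let $s=p_1\cdots p_z$ be its non-overlapping LZ factorization. Then $m<2z$.
   Context: Strings are over a finite linearly ordered alphabet $\Sigma$. Lexicographic order: $u\preceq v$ if either $u$ is a prefix of $v$, or $u=xaw_1$, $v=xbw_2$ for strings $x,w_1,w_2$ and letters $a\prec b$. A Lyndon word is a nonempty string that is strictly lexicographically smaller than each of its nonempty proper suffixes. The Lyndon factorization of $s$ is the unique factorization $s=f_1^{e_1}\cdots f_m^{e_m}$ in which every $f_i$ is a Lyndon word, every $e_i\ge 1$, and $f_i\succ f_{i+1}$ for $1\le i<m$; its size is $m$. The non-overlapping LZ factorization $s=p_1\cdots p_z$ is built greedily from left to right: each phrase $p_i$ is either the leftmost occurrence in $s$ of a letter, or the longest prefix of $p_i\cdots p_z$ that occurs as a substring of $p_1\cdots p_{i-1}$; its size is $z$.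
   Formalization: The string s is assumed nonempty: for the empty string both factorizations are empty, so m = z = 0 and the claimed strict inequality m < 2z fails. -}

module Defs where

open import Data.Nat using (ℕ; suc; _≤_; _<_)
open import Data.Fin using (Fin)
import Data.Fin as F
open import Data.List using (List; []; _∷_; _++_; length; replicate; concat; concatMap)
open import Data.List.Membership.Propositional using (_∈_)
open import Data.Product using (Σ; ∃; _×_; _,_)
open import Data.Sum using (_⊎_)
open import Relation.Binary.PropositionalEquality using (_≡_)
open import Relation.Nullary using (¬_)

Str : ℕ → Set
Str σ = List (Fin σ)

NonEmpty : {σ : ℕ} → Str σ → Set
NonEmpty s = ∃ λ a → ∃ λ t → s ≡ a ∷ t

_≺_ : {σ : ℕ} → Str σ → Str σ → Set
_≺_ {σ} u v =
  (Σ (Str σ) λ w → NonEmpty w × v ≡ u ++ w)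
  ⊎ (Σ (Str σ) λ x → Σ (Fin σ) λ a → Σ (Fin σ) λ b →
       Σ (Str σ) λ w₁ → Σ (Str σ) λ w₂ →
         (a F.< b) × (u ≡ x ++ (a ∷ w₁)) × (v ≡ x ++ (b ∷ w₂)))

IsLyndon : {σ : ℕ} → Str σ → Set
IsLyndon {σ} w = NonEmpty w ×
  ((x t : Str σ) → NonEmpty x → NonEmpty t → w ≡ x ++ t → w ≺ t)

-- A factor f^(suc e) is represented by the pair (f , e).
expand : {σ : ℕ} → List (Str σ × ℕ) → Str σ
expand [] = []
expand ((f , e) ∷ fs) = concat (replicate (suc e) f) ++ expand fs

Decreasing : {σ : ℕ} → List (Str σ × ℕ) → Set
Decreasing [] = Data.Unit.⊤ where import Data.Unit
Decreasing (_ ∷ []) = Data.Unit.⊤ where import Data.Unit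
Decreasing ((f , _) ∷ (g , e) ∷ fs) = (g ≺ f) × Decreasing ((g , e) ∷ fs)

AllLyndon : {σ : ℕ} → List (Str σ × ℕ) → Set
AllLyndon [] = Data.Unit.⊤ where import Data.Unit
AllLyndon ((f , _) ∷ fs) = IsLyndon f × AllLyndon fs

IsLyndonFactorization : {σ : ℕ} → Str σ → List (Str σ × ℕ) → Set
IsLyndonFactorization s fs = AllLyndon fs × Decreasing fs × (expand fs ≡ s)

SubstringOf : {σ : ℕ} → Str σ → Str σ → Set
SubstringOf {σ} q u = Σ (Str σ) λ x → Σ (Str σ) λ y → u ≡ x ++ q ++ y

PrefixOf : {σ : ℕ} → Str σ → Str σ → Set
PrefixOf {σ} q u = Σ (Str σ) λ y → u ≡ q ++ y

LZPhrase : {σ : ℕ} → Str σ → Str σ → Str σ → Set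
LZPhrase {σ} prev p rest =
  (Σ (Fin σ) λ a → (p ≡ a ∷ []) × ¬ (a ∈ prev))
  ⊎ (NonEmpty p × SubstringOf p prev ×
     ((q : Str σ) → PrefixOf q (p ++ rest) → SubstringOf q prev → length q ≤ length p))

LZFrom : {σ : ℕ} → Str σ → List (Str σ) → Set
LZFrom prev [] = Data.Unit.⊤ where import Data.Unit
LZFrom prev (p ∷ ps) = LZPhrase prev p (concat ps) × LZFrom (prev ++ p) ps

IsLZFactorization : {σ : ℕ} → Str σ → List (Str σ) → Set
IsLZFactorization s ps = (concat ps ≡ s) × LZFrom [] ps

{-# OPTIONS --safe #-}
-- The invariant is that after k phrases every Lyndon factorization of every
-- prefix of the text read so far has at most 2k − 1 runs.  Suppose a new phrase
-- p extends the text s, and let the end of s cut the run f^e in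
-- F₁ ⋯ F_i f^e W, where W is a concatenation of runs with smaller factors.
-- Then W occurs in s.  If it meets one of F₁, …, F_i, then the factor x
-- containing the start of that occurrence satisfies x ≤ W r, where W r is the
-- rest of s.  Every Lyndon word z with g < z ≤ W r for all factors g of W has
-- W as a prefix; applying this to the factor of F_i, the word
-- F₁ ⋯ F_{i-1} W is a prefix of s with only two runs fewer.  Otherwise W occurs
-- within the part of f^e belonging to s, so that part begins with W by the same
-- argument for z = f, and F₁ ⋯ F_i W is a prefix of s with one run fewer.
module Submission where

open import Defs
open import Data.Nat using (ℕ; suc; _+_; _<_; _*_; _≤_; z≤n; s≤s)
open import Data.Nat.Properties using (≤-trans; ≤-reflexive; m≤n⇒m≤1+n; +-suc; +-comm; *-suc)
open import Data.Fin using (Fin)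
import Data.Fin as F
import Data.Fin.Properties as F
open import Data.List using (List; []; _∷_; _++_; _∷ʳ_; length; replicate; concat; initLast; _∷ʳ′_)
open import Data.List.Properties using (++-assoc; ++-identityʳ; ++-conicalˡ; ++-conicalʳ; concat-++; ∷-injective; length-++-sucʳ; length-++-≤ˡ; length-++-≤ʳ)
open import Data.List.Relation.Binary.Lex.Strict using (Lex-<; base; halt; this; next; <-irreflexive; <-transitive)
import Data.List.Relation.Binary.Pointwise as Pointwise
open import Data.List.Relation.Unary.All using (All; []; _∷_)
import Data.List.Relation.Unary.All as All
import Data.List.Relation.Unary.All.Properties as All
open import Data.List.Relation.Unary.AllPairs using (AllPairs; []; _∷_)
import Data.List.Relation.Unary.AllPairs.Properties as AllPairs
open import Data.List.Relation.Unary.Any using (Any; here; there)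
open import Data.List.Relation.Unary.Linked using (Linked; []; [-]; _∷_)
open import Data.List.Relation.Unary.Linked.Properties using (Linked⇒AllPairs)
open import Data.Product using (∃; _×_; _,_; proj₁; proj₂)
open import Data.Sum using (_⊎_; inj₁; inj₂)
open import Function using (_∘_)
open import Relation.Binary.PropositionalEquality
  using (_≡_; refl; sym; trans; cong; subst; subst₂; isEquivalence; resp₂; module ≡-Reasoning)
open import Relation.Nullary using (¬_; contradiction)

private variable
  σ k : ℕ
  p r s t u v w z : Str σ
  fs gs : List (Str σ × ℕ)

-- Lexicographic order

infix 4 _⊏_ _⊑_

_⊏_ : Str σ → Str σ → Set
_⊏_ = Lex-< _≡_ F._<_

_⊑_ : Str σ → Str σ → Set
u ⊑ v = u ⊏ v ⊎ u ≡ v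

⊏-irrefl : ¬ u ⊏ u
⊏-irrefl = <-irreflexive F.<-irrefl (Pointwise.refl refl)

⊏-trans : u ⊏ v → v ⊏ w → u ⊏ w
⊏-trans = <-transitive isEquivalence (resp₂ F._<_) F.<-trans

⊏-⊑-trans : u ⊏ v → v ⊑ w → u ⊏ w
⊏-⊑-trans u⊏v (inj₁ v⊏w)  = ⊏-trans u⊏v v⊏w
⊏-⊑-trans u⊏v (inj₂ refl) = u⊏v

≺⇒⊏ : (u v : Str σ) → u ≺ v → u ⊏ v
≺⇒⊏ u _ (inj₁ (_ , (_ , _ , refl) , refl)) = proper u
  where
  proper : ∀ u {a w} → u ⊏ u ++ a ∷ w
  proper []      = halt
  proper (_ ∷ u) = next refl (proper u)
≺⇒⊏ _ _ (inj₂ (x , a , b , _ , _ , a<b , refl , refl)) = mismatch x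
  where
  mismatch : ∀ x {w₁ w₂} → x ++ a ∷ w₁ ⊏ x ++ b ∷ w₂
  mismatch []      = this a<b
  mismatch (_ ∷ x) = next refl (mismatch x)

prefix⇒¬⊏ : (v : Str σ) → ¬ v ++ t ⊏ v
prefix⇒¬⊏ []      (base ())
prefix⇒¬⊏ (_ ∷ v) (this a<a)   = F.<-irrefl refl a<a
prefix⇒¬⊏ (_ ∷ v) (next _ lt)  = prefix⇒¬⊏ v lt

-- A mismatch that decides `h ⊏ v` would decide `h ++ r ⊏ v` as well. So `h` can only be smaller by
-- being a proper prefix, and the comparison passes to what follows it.
⊏-between : (h : Str σ) → h ⊏ v → ¬ h ++ r ⊏ v →
            ∃ λ v′ → NonEmpty v′ × v ≡ h ++ v′ × ¬ r ⊏ v′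
⊏-between []      halt          ≮ = _ , (_ , _ , refl) , refl , ≮
⊏-between (_ ∷ h) (this a<b)    ≮ = contradiction (this a<b) ≮
⊏-between (_ ∷ h) (next refl lt) ≮ with ⊏-between h lt (≮ ∘ next refl)
... | v′ , ne , refl , ≮′ = v′ , ne , refl , ≮′

-- Splitting concatenations

++-split : (xs : Str σ) {ys : Str σ} (us : Str σ) {vs : Str σ} → xs ++ ys ≡ us ++ vs →
           (∃ λ t → us ≡ xs ++ t × ys ≡ t ++ vs) ⊎
           (∃ λ t → NonEmpty t × xs ≡ us ++ t × vs ≡ t ++ ys)
++-split []       us       eq = inj₁ (us , refl , eq)
++-split (x ∷ xs) []       eq = inj₂ (x ∷ xs , (_ , _ , refl) , refl , sym eq)
++-split (x ∷ xs) (u ∷ us) eq with ∷-injective eq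
... | refl , eq′ with ++-split xs us eq′
...   | inj₁ (t , refl , q)      = inj₁ (t , refl , q)
...   | inj₂ (t , ne , refl , q) = inj₂ (t , ne , refl , q)

AllPairs-++⁻ : ∀ {A : Set} {R : A → A → Set} (xs : List A) {ys} → AllPairs R (xs ++ ys) →
               AllPairs R xs × AllPairs R ys × All (λ x → All (R x) ys) xs
AllPairs-++⁻ []       ps       = [] , ps , []
AllPairs-++⁻ (x ∷ xs) (p ∷ ps) with All.++⁻ xs p | AllPairs-++⁻ xs ps
... | pˡ , pʳ | psˡ , psʳ , qs = pˡ ∷ psˡ , psʳ , pʳ ∷ qs

-- Lyndon words and the start of an occurrence

lyndon-⊑-suffix : IsLyndon z → (u : Str σ) → NonEmpty v → z ≡ u ++ v → z ⊑ v
lyndon-⊑-suffix _       []      _  eq = inj₂ eq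
lyndon-⊑-suffix (_ , ≺) (a ∷ u) ne eq = inj₁ (≺⇒⊏ _ _ (≺ (a ∷ u) _ (_ , _ , refl) ne eq))

-- Generalized from `z` to its suffixes `v` for the induction: `h ⊏ z ⊑ v` lets `⊏-between` strip
-- `h` off `v`, and what remains is again a nonempty suffix of `z`, hence again at least `z`.
lyndon-suffix-prefix : ∀ {v : Str σ} (hs : List (Str σ)) → All (_⊏ z) hs → IsLyndon z →
  (u : Str σ) → z ≡ u ++ v → NonEmpty v → ¬ concat hs ++ r ⊏ v → PrefixOf (concat hs) v
lyndon-suffix-prefix []       _          _  _ _  _  _ = _ , refl
lyndon-suffix-prefix {r = r} (h ∷ hs) (h⊏z ∷ hs⊏z) lz u eq ne ≮
  with ⊏-between h (⊏-⊑-trans h⊏z (lyndon-⊑-suffix lz u ne eq))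
                 (≮ ∘ subst (_⊏ _) (sym (++-assoc h (concat hs) r)))
... | v′ , ne′ , refl , ≮′
  with lyndon-suffix-prefix hs hs⊏z lz (u ++ h) (trans eq (sym (++-assoc u h v′))) ne′ ≮′
... | y , refl = y , sym (++-assoc h (concat hs) y)

lyndon-prefix : (hs : List (Str σ)) → All (_⊏ z) hs → IsLyndon z →
  ¬ concat hs ++ r ⊏ z → PrefixOf (concat hs) z
lyndon-prefix hs hs⊏z lz = lyndon-suffix-prefix hs hs⊏z lz [] refl (proj₁ lz)

-- Only the start of the occurrence matters; its end may lie several factors later. A start on a
-- border counts for what follows the border.
locate : ∀ {a : Str σ} (xs : List (Str σ)) → All IsLyndon xs → (u : Str σ) →
  concat xs ++ a ≡ u ++ w ++ r → Any (λ x → ¬ w ++ r ⊏ x) xs ⊎ SubstringOf w a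
locate []       _        u eq = inj₂ (u , _ , eq)
locate {a = a} (x ∷ xs) (lx ∷ lxs) u eq
  with ++-split x u (trans (sym (++-assoc x (concat xs) a)) eq)
... | inj₁ (t , _ , eq′) with locate xs lxs t eq′
...   | inj₁ i = inj₁ (there i)
...   | inj₂ o = inj₂ o
locate {a = a} (x ∷ xs) (lx ∷ lxs) u eq
    -- The occurrence starts in `x`, at its suffix `t`. Since `t` is a prefix of `w ++ r` and
    -- `x ⊑ t`, having `w ++ r ⊏ x` would put a word below its own prefix.
    | inj₂ (t , ne , x≡ , eq′) = inj₁ (here λ lt →
  prefix⇒¬⊏ t (subst (_⊏ t) eq′ (⊏-⊑-trans lt (lyndon-⊑-suffix lx u ne x≡))))

-- Runs of Lyndon factors

run : Str σ × ℕ → List (Str σ)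
run (f , e) = replicate (suc e) f

factors : List (Str σ × ℕ) → List (Str σ)
factors []       = []
factors (g ∷ fs) = run g ++ factors fs

concat-factors : (fs : List (Str σ × ℕ)) → concat (factors fs) ≡ expand fs
concat-factors []       = refl
concat-factors (g ∷ fs) = trans (sym (concat-++ (run g) (factors fs)))
                                (cong (concat (run g) ++_) (concat-factors fs))

expand-++ : (fs gs : List (Str σ × ℕ)) → expand (fs ++ gs) ≡ expand fs ++ expand gs
expand-++ []       gs = refl
expand-++ (g ∷ fs) gs = trans (cong (concat (run g) ++_) (expand-++ fs gs))
                              (sym (++-assoc (concat (run g)) (expand fs) (expand gs)))

All-factors : ∀ {P : Str σ → Set} → All (P ∘ proj₁) fs → All P (factors fs)
All-factors []                   = []
All-factors {fs = (_ , e) ∷ _} (p ∷ ps) = All.++⁺ (All.replicate⁺ (suc e) p) (All-factors ps)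

_⊐₁_ : Str σ × ℕ → Str σ × ℕ → Set
g ⊐₁ h = proj₁ h ⊏ proj₁ g

-- Comparing all pairs, not only neighbours, makes the property survive the deletion of a run from
-- the middle.
LyndonRuns : List (Str σ × ℕ) → Set
LyndonRuns fs = All (IsLyndon ∘ proj₁) fs × AllPairs _⊐₁_ fs

allLyndon⇒All : (fs : List (Str σ × ℕ)) → AllLyndon fs → All (IsLyndon ∘ proj₁) fs
allLyndon⇒All []       _        = []
allLyndon⇒All (_ ∷ fs) (l , ls) = l ∷ allLyndon⇒All fs ls

decreasing⇒Linked : (fs : List (Str σ × ℕ)) → Decreasing fs → Linked _⊐₁_ fs
decreasing⇒Linked []           _        = []
decreasing⇒Linked (_ ∷ [])     _        = [-]
decreasing⇒Linked (_ ∷ _ ∷ fs) (g≺ , d) = ≺⇒⊏ _ _ g≺ ∷ decreasing⇒Linked (_ ∷ fs) d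

decreasing⇒AllPairs : (fs : List (Str σ × ℕ)) → Decreasing fs → AllPairs _⊐₁_ fs
decreasing⇒AllPairs fs = Linked⇒AllPairs (λ g⊐ h⊐ → ⊏-trans h⊐ g⊐) ∘ decreasing⇒Linked fs

lyndonRuns-++ : (fs : List (Str σ × ℕ)) → LyndonRuns (fs ++ gs) →
                LyndonRuns fs × LyndonRuns gs × All (λ g → All (g ⊐₁_) gs) fs
lyndonRuns-++ fs (ls , ps) with All.++⁻ fs ls | AllPairs-++⁻ fs ps
... | lˡ , lʳ | pˡ , pʳ , qs = (lˡ , pˡ) , (lʳ , pʳ) , qs

lyndonRuns-skip : ∀ (fs : List (Str σ × ℕ)) {g} → LyndonRuns (fs ++ g ∷ gs) → LyndonRuns (fs ++ gs)
lyndonRuns-skip fs runs with lyndonRuns-++ fs runs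
... | (lˡ , pˡ) , (_ ∷ lʳ , _ ∷ pʳ) , qs = All.++⁺ lˡ lʳ , AllPairs.++⁺ pˡ pʳ (All.map All.tail qs)

lyndonRuns-prefix : ∀ (g : Str σ × ℕ) → LyndonRuns (g ∷ gs) → ¬ expand gs ++ r ⊏ proj₁ g →
  PrefixOf (expand gs) (proj₁ g)
lyndonRuns-prefix {gs = gs} {r = r} (g , _) (lg ∷ _ , g⊐ ∷ _) ≮ =
  subst (λ w → PrefixOf w g) (concat-factors gs)
    (lyndon-prefix {r = r} (factors gs) (All-factors g⊐) lg
      (≮ ∘ subst (λ w → w ++ r ⊏ g) (concat-factors gs)))

-- The run cut by the end of the old text

record Cut (fs : List (Str σ × ℕ)) (s p : Str σ) : Set where
  constructor mkCut
  field
    as bs  : List (Str σ × ℕ)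
    g      : Str σ × ℕ
    a b    : Str σ
    fs≡    : fs ≡ as ++ g ∷ bs
    s≡     : s ≡ expand as ++ a
    run≡   : concat (run g) ≡ a ++ b
    -- A cut on the border of two runs thus belongs to the later one, with `a` empty, and
    -- `expand bs` starts after the first letter of `p`.
    b≢[]   : NonEmpty b
    p≡     : p ≡ b ++ expand bs

cut : (fs : List (Str σ × ℕ)) (s : Str σ) → NonEmpty p → expand fs ≡ s ++ p → Cut fs s p
cut []       []      (_ , _ , refl) ()
cut (g ∷ fs) s ne eq with ++-split (concat (run g)) s eq
... | inj₂ (t , ne′ , eq₁ , eq₂) = mkCut [] fs g s t refl refl eq₁ ne′ eq₂
... | inj₁ (t , refl , eq₂) with cut fs t ne eq₂
...   | mkCut as bs h a b refl refl run≡ b≢[] p≡ =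
  mkCut (g ∷ as) bs h a b refl (sym (++-assoc (concat (run g)) (expand as) a)) run≡ b≢[] p≡

-- All prefixes are covered because deleting runs leaves the factorization of a shorter prefix.
Bound : ℕ → Str σ → Set
Bound k s = ∀ fs → LyndonRuns fs → PrefixOf (expand fs) s → length fs ≤ k

-- What both kinds of phrase have in common. The tail `y` allows for a factorized prefix that stops
-- inside `p`.
ProperSuffixesOccur : Str σ → Str σ → Set
ProperSuffixesOccur p s = ∀ b w y → NonEmpty b → p ≡ b ++ w ++ y → SubstringOf w s

prefix-weaken : (u : Str σ) → PrefixOf w v → PrefixOf w (v ++ u)
prefix-weaken {w = w} u (y , refl) = y ++ u , ++-assoc w y u

prefix-prepend : (u : Str σ) → PrefixOf w v → PrefixOf (u ++ w) (u ++ v)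
prefix-prepend {w = w} u (y , refl) = y , sym (++-assoc u w y)

prefix-shorten : (w a : Str σ) → length w ≤ length a → ∀ {b y} → a ++ b ≡ w ++ y → PrefixOf w a
prefix-shorten []      a       _         _  = a , refl
prefix-shorten (_ ∷ w) (_ ∷ a) (s≤s w≤a) eq with ∷-injective eq
... | refl , eq′ with prefix-shorten w a w≤a eq′
...   | y , refl = y , refl

substring-length : SubstringOf w v → length w ≤ length v
substring-length {w = w} (x , y , refl) = ≤-trans (length-++-≤ˡ w) (length-++-≤ʳ (w ++ y) {x})

prefix-of-nothing : SubstringOf w [] → PrefixOf w v
prefix-of-nothing {w = w} (x , y , eq)
  rewrite ++-conicalˡ w y (++-conicalʳ x (w ++ y) (sym eq)) = _ , refl

-- Deleting one or two runs

bound-within-run : ∀ (as bs : List (Str σ × ℕ)) g {a b} → Bound k (expand as ++ a) →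
  LyndonRuns (as ++ g ∷ bs) → concat (run g) ≡ a ++ b → SubstringOf (expand bs) a →
  length (as ++ g ∷ bs) ≤ suc k
bound-within-run as bs g {a} {b} bound runs run≡ o@(u , r , a≡) =
  ≤-trans (≤-reflexive (length-++-sucʳ as g bs))
    (s≤s (bound (as ++ bs) (lyndonRuns-skip as runs)
      (subst (λ w → PrefixOf w (expand as ++ a)) (sym (expand-++ as bs))
        (prefix-prepend (expand as) W-prefix-a))))
  where
  W = expand bs
  g∷bs : LyndonRuns (g ∷ bs)
  g∷bs = proj₁ (proj₂ (lyndonRuns-++ as runs))

  occurrence : concat (run g) ++ [] ≡ u ++ W ++ (r ++ b)
  occurrence = begin
    concat (run g) ++ []   ≡⟨ ++-identityʳ _ ⟩
    concat (run g)         ≡⟨ run≡ ⟩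
    a ++ b                 ≡⟨ cong (_++ b) a≡ ⟩
    (u ++ W ++ r) ++ b     ≡⟨ ++-assoc u (W ++ r) b ⟩
    u ++ (W ++ r) ++ b     ≡⟨ cong (u ++_) (++-assoc W r b) ⟩
    u ++ W ++ (r ++ b)     ∎
    where open ≡-Reasoning

  g≡run : All (proj₁ g ≡_) (run g)
  g≡run = All.replicate⁺ (suc (proj₂ g)) refl

  W-prefix-g : PrefixOf W (proj₁ g)
  W-prefix-g with locate (run g) (All.replicate⁺ (suc (proj₂ g)) (All.head (proj₁ g∷bs))) u occurrence
  -- Nothing follows the run here, so an occurrence past its last copy is one of the empty word.
  ... | inj₂ o′ = prefix-of-nothing o′
  ... | inj₁ i with All.lookupAny g≡run i
  ...   | g≡x , ≮ = lyndonRuns-prefix g g∷bs (subst (λ x → ¬ W ++ (r ++ b) ⊏ x) (sym g≡x) ≮)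

  W-prefix-a : PrefixOf W a
  -- A prefix of the factor is a prefix of the run `a ++ b`; as `W` also occurs in `a`, it is short
  -- enough to end within `a`.
  W-prefix-a = prefix-shorten W a (substring-length o)
    (trans (sym run≡) (proj₂ (prefix-weaken (concat (replicate (proj₂ g) (proj₁ g))) W-prefix-g)))

-- The run given up along with `g` is the last one before it: its factor is least among those of
-- `as`, so the inequality for whichever factor was hit carries over to it.
bound-before-run : ∀ (as bs : List (Str σ × ℕ)) g {a} → Bound k (expand as ++ a) →
  LyndonRuns (as ++ g ∷ bs) → Any (λ x → ¬ expand bs ++ r ⊏ x) (factors as) →
  length (as ++ g ∷ bs) ≤ suc (suc k)
bound-before-run as bs g bound runs i with initLast as
bound-before-run .[] bs g bound runs () | []
bound-before-run {r = r} .(as ∷ʳ h) bs g {a} bound runs i | as ∷ʳ′ h =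
  ≤-trans (≤-reflexive (trans (length-++-sucʳ (as ∷ʳ h) g bs)
                              (cong (suc ∘ length) (++-assoc as (h ∷ []) bs))))
    (s≤s (≤-trans (≤-reflexive (length-++-sucʳ as h bs))
      (s≤s (bound (as ++ bs) (lyndonRuns-skip as runs′)
        (subst₂ PrefixOf (sym (expand-++ as bs)) (sym s≡)
          (prefix-prepend (expand as) (prefix-weaken _ W-prefix-h)))))))
  where
  W = expand bs
  -- Dropping `g` puts `h` directly before `bs`, as `lyndonRuns-prefix` requires.
  runs′ : LyndonRuns (as ++ h ∷ bs)
  runs′ = subst LyndonRuns (++-assoc as (h ∷ []) bs) (lyndonRuns-skip (as ∷ʳ h) runs)

  h-least : All (λ x → proj₁ h ⊑ x) (factors (as ∷ʳ h))
  h-least = All-factors (All.∷ʳ⁺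
    (All.map (inj₁ ∘ All.head) (proj₂ (proj₂ (lyndonRuns-++ as runs′)))) (inj₂ refl))

  W-prefix-h : PrefixOf W (proj₁ h)
  W-prefix-h with All.lookupAny h-least i
  ... | h⊑x , ≮ = lyndonRuns-prefix h (proj₁ (proj₂ (lyndonRuns-++ as runs′))) λ lt → ≮ (⊏-⊑-trans lt h⊑x)

  s≡ : expand (as ∷ʳ h) ++ a ≡ expand as ++ proj₁ h ++ ((concat (replicate (proj₂ h) (proj₁ h)) ++ []) ++ a)
  s≡ = begin
    expand (as ∷ʳ h) ++ a                    ≡⟨ cong (_++ a) (expand-++ as (h ∷ [])) ⟩
    (expand as ++ expand (h ∷ [])) ++ a      ≡⟨ ++-assoc (expand as) _ a ⟩
    expand as ++ expand (h ∷ []) ++ a        ≡⟨ cong (λ q → expand as ++ q ++ a) (++-assoc (proj₁ h) _ []) ⟩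
    expand as ++ (proj₁ h ++ _) ++ a         ≡⟨ cong (expand as ++_) (++-assoc (proj₁ h) _ a) ⟩
    _                                        ∎
    where open ≡-Reasoning

-- A prefix that ends in `s` costs nothing, an occurrence starting in `a` costs one run, and one
-- starting in an earlier factor costs two.
bound-step : Bound k s → ProperSuffixesOccur p s → Bound (suc (suc k)) (s ++ p)
bound-step {s = s} bound occurs fs runs (y , eq) with ++-split (expand fs) s (sym eq)
... | inj₁ (t , s≡ , _) = m≤n⇒m≤1+n (m≤n⇒m≤1+n (bound fs runs (t , s≡)))
... | inj₂ (t , ne , fs≡ , p≡) with cut fs s ne fs≡
...   | mkCut as bs g a b refl refl run≡ b≢[] refl
  with occurs b (expand bs) y b≢[] (trans p≡ (++-assoc b (expand bs) y))
...     | u , r , s≡ with locate (factors as) (All-factors (proj₁ (proj₁ (lyndonRuns-++ as runs)))) u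
                            (trans (cong (_++ a) (concat-factors as)) s≡)
...       | inj₁ i = bound-before-run as bs g bound runs i
...       | inj₂ o = m≤n⇒m≤1+n (bound-within-run as bs g bound runs run≡ o)

-- Counting over the LZ phrases

phrase-suffixes-occur : ∀ (s p : Str σ) {rest} → LZPhrase s p rest → ProperSuffixesOccur p s
-- The nonempty `b` uses up the single letter, so `w` is empty.
phrase-suffixes-occur s _ (inj₁ (_ , refl , _)) _ w y (_ , b , refl) eq
  rewrite ++-conicalˡ w y (++-conicalʳ b (w ++ y) (sym (proj₂ (∷-injective eq)))) = [] , s , refl
phrase-suffixes-occur s _ (inj₂ (_ , (x , x′ , s≡) , _)) b w y _ refl = x ++ b , y ++ x′ , trans s≡ (begin
  x ++ (b ++ w ++ y) ++ x′      ≡⟨ cong (x ++_) (++-assoc b (w ++ y) x′) ⟩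
  x ++ b ++ (w ++ y) ++ x′      ≡⟨ ++-assoc x b _ ⟨
  (x ++ b) ++ (w ++ y) ++ x′    ≡⟨ cong ((x ++ b) ++_) (++-assoc w y x′) ⟩
  (x ++ b) ++ w ++ (y ++ x′)    ∎)
  where open ≡-Reasoning

lz-bound : ∀ (ps : List (Str σ)) {s} → LZFrom s ps → Bound k s → Bound (2 * length ps + k) (s ++ concat ps)
lz-bound []       {s} _         bound = subst (Bound _) (sym (++-identityʳ s)) bound
lz-bound {k = k} (p ∷ ps) {s} (ph , lz) bound =
  subst₂ Bound arith (++-assoc s p (concat ps))
    (lz-bound ps lz (bound-step bound (phrase-suffixes-occur s p ph)))
  where
  arith : 2 * length ps + suc (suc k) ≡ 2 * suc (length ps) + k
  arith = begin
    2 * length ps + suc (suc k)     ≡⟨ +-suc (2 * length ps) (suc k) ⟩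
    suc (2 * length ps + suc k)     ≡⟨ cong suc (+-suc (2 * length ps) k) ⟩
    suc (suc (2 * length ps + k))   ≡⟨ cong (_+ k) (*-suc 2 (length ps)) ⟨
    2 * suc (length ps) + k         ∎
    where open ≡-Reasoning

length-expand : (fs : List (Str σ × ℕ)) → All (IsLyndon ∘ proj₁) fs → length fs ≤ length (expand fs)
length-expand []             _                             = z≤n
length-expand ((f , e) ∷ fs) (((_ , t , refl) , _) ∷ ls) =
  s≤s (≤-trans (length-expand fs ls) (length-++-≤ʳ (expand fs) {t ++ concat (replicate e f)}))

-- Nothing nonempty occurs in the empty text, so the first phrase is a single letter. It contributes
-- one run where later phrases may contribute two, which makes the final inequality strict.
first-phrase-bound : ∀ (p : Str σ) {rest} → LZPhrase [] p rest → Bound 1 p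
first-phrase-bound _ (inj₁ (_ , refl , _)) fs (ls , _) (y , eq) =
  ≤-trans (length-expand fs ls) (≤-trans (length-++-≤ˡ (expand fs)) (≤-reflexive (cong length (sym eq))))
first-phrase-bound _ (inj₂ ((_ , _ , refl) , ([] , _ , ()) , _))
first-phrase-bound _ (inj₂ ((_ , _ , refl) , (_ ∷ _ , _ , ()) , _))

theorem1 : (σ : ℕ) (s : Str σ) → NonEmpty s →
    (fs : List (Str σ × ℕ)) → IsLyndonFactorization s fs →
    (ps : List (Str σ)) → IsLZFactorization s ps →
    length fs < 2 * length ps
theorem1 σ _ (_ , _ , ()) fs _ [] (refl , _)
theorem1 σ _ _ fs (lyndon , decr , fs≡) (p ∷ ps) (refl , ph , lz) =
  -- Starting from 1 after the first phrase, the remaining ones give `2 * length ps + 1`, one less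
  -- than twice the number of all phrases.
  ≤-trans (s≤s (lz-bound ps lz (first-phrase-bound p ph) fs
                 (allLyndon⇒All fs lyndon , decreasing⇒AllPairs fs decr)
                 ([] , sym (trans (++-identityʳ (expand fs)) fs≡))))
          (≤-reflexive arith)
  where
  arith : suc (2 * length ps + 1) ≡ 2 * suc (length ps)
  arith = trans (cong suc (+-comm (2 * length ps) 1)) (sym (*-suc 2 (length ps)))
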